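{- Let $G$ be a connected graph with $|G|\ge 2$, let $H$ be a graph, and let $K$ be a nonempty induced subgraph of the lexicographic product $G[H]$, with projection $\pi(K)$. Then: if $|\pi(K)|\ge 2$, $K\le G[H]$ if and only if $\pi(K)\le G$; and if $|\pi(K)|=1$, $K\le G[H]$ if and only if $\operatorname{diam}(K)\le 2$.
   Context: All graphs are finite, undirected and simple; $|G|$ denotes the number of vertices of $G$. The distance $d_G(u,v)$ is the minimum length (number of edges) of a path from $u$ to $v$ in $G$, and $d_G(u,v)=\infty$ if no such path exists. A subgraph $K$ of $G$ is isometric, written $K\le G$, if $d_K(u,v)=d_G(u,v)$ for every pair of vertices $u,v\in V(K)$. The diameter $\operatorname{diam}(K)$ is the maximum of $d_K(p,q)$ over vertices $p,q$ of $K$ (so it is $\infty$ if $K$ is disconnected). The lexicographic product $G[H]$ is the graph with vertex set $V(G)\times V(H)$ and edge set $E(G[H])=\{(u,x)(v,y) : uv\in E(G),\text{ or } (xy\in E(H)\text{ and }u=v)\}$. The projection $\pi(K)$ of a subgraph $K$ of $G[H]$ is the induced subgraph of $G$ whose vertex set is $\{u : (u,x)\text{ is a vertex of }K \text{ for some } x\in V(H)\}$. -}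

module Defs where

open import Data.Empty using (⊥-elim-irr)
open import Data.Fin as Fin using (Fin; zero; suc)
import Data.Fin.Properties as Fin
import Data.Irrelevant as Irrelevant
open import Data.List using (List; []; _∷_; map; filter; upTo; allFin; cartesianProduct; length; lookup)
import Data.List.Extrema as Extrema
open import Data.List.Membership.Propositional.Properties using (∈-lookup)
import Data.List.Relation.Unary.All as All
open import Data.List.Relation.Unary.AllPairs using (_∷_)
open import Data.List.Relation.Unary.Unique.Propositional using (Unique)
open import Data.List.Relation.Unary.Unique.DecPropositional using (unique?)
open import Data.Nat as ℕ using (ℕ; zero; suc; _<_)
open import Data.Nat.Properties using (≤-isTotalOrder)
open import Data.Product using (∃; ∃-syntax; Σ-syntax; _×_; _,_; proj₁; proj₂; uncurry)
open import Data.Product.Function.NonDependent.Propositional using (_×-↔_)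
open import Data.Refinement using (Refinement; Refinement-syntax; _,_; value; value-injective)
open import Data.Sum using (_⊎_; inj₁; inj₂)
open import Function using (_∘_; _↔_; mk↔ₛ′; Injection; Inverse)
open import Function.Construct.Composition using (_↔-∘_)
open import Function.Properties.Inverse using (↔-sym; ↔⇒↣)
open import Level using (0ℓ)
open import Relation.Binary using (Rel; Decidable; DecidableEquality; Symmetric; Irreflexive; TotalOrder)
import Relation.Binary.Construct.Add.Supremum.NonStrict ℕ._≤_ as Supremum
open import Relation.Binary.PropositionalEquality
  using (_≡_; refl; sym; cong; subst)
open import Relation.Nullary using (Dec; yes; no; contradiction; map′; _×-dec_; _⊎-dec_)
open import Relation.Nullary.Construct.Add.Supremum using (_⁺) renaming ([_] to fin; ⊤⁺ to ∞) public
import Relation.Unary as U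

ℕ∞ : Set
ℕ∞ = ℕ ⁺

open Supremum public using () renaming (_≤⁺_ to _≤∞_)

≤∞-totalOrder : TotalOrder 0ℓ 0ℓ 0ℓ
≤∞-totalOrder = record { isTotalOrder = Supremum.≤⁺-isTotalOrder-≡ ≤-isTotalOrder }

-- Finiteness is a bijection with Fin order. Edge (and, for subgraphs,
-- membership) predicates are decidable, as is automatic classically.
record Graph : Set₁ where
  infix 4 _~_ _~?_ _≟_
  field
    V      : Set
    order  : ℕ
    V↔Fin  : V ↔ Fin order
    _~_    : Rel V 0ℓ
    _~?_   : Decidable _~_
    ~-sym  : Symmetric _~_
    ~-irr  : Irreflexive _≡_ _~_

  _≟_ : DecidableEquality V
  _≟_ = Fin.inj⇒≟ (↔⇒↣ V↔Fin)

  vertices : List V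
  vertices = map (Inverse.from V↔Fin) (allFin order)

  any? : {P : U.Pred V 0ℓ} → U.Decidable P → Dec (∃ P)
  any? {P} P? = map′
    (λ (i , p) → from i , p)
    (λ (v , p) → to v , subst P (sym (strictlyInverseʳ v)) p)
    (Fin.any? (P? ∘ from))
    where open Inverse V↔Fin

open Graph using (V)

∣_∣ : Graph → ℕ
∣_∣ = Graph.order

module _ (G : Graph) where
  open Graph G hiding (V)

  data Walk : ℕ → V G → V G → Set where
    nil  : ∀ {u} → Walk 0 u u
    cons : ∀ {n u v w} → u ~ v → Walk n v w → Walk (suc n) u w

module _ {G : Graph} where
  open Graph G hiding (V)

  support : ∀ {n u v} → Walk G n u v → List (V G)
  support {u = u} nil        = u ∷ []
  support {u = u} (cons _ p) = u ∷ support p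

  -- Recursion on the length; Q constrains only the support of the walk.
  walk? : {Q : U.Pred (List (V G)) 0ℓ} → U.Decidable Q →
          ∀ n u v → Dec (Σ[ p ∈ Walk G n u v ] Q (support p))
  walk? {Q} Q? zero u v with u ≟ v
  ... | no u≢v   = no λ { (nil , _) → u≢v refl }
  ... | yes refl = map′ (nil ,_) (λ { (nil , q) → q }) (Q? (u ∷ []))
  walk? {Q} Q? (suc n) u w = map′
    (λ (_ , e , p , q) → cons e p , q)
    (λ { (cons e p , q) → _ , e , p , q })
    (any? λ v → (u ~? v) ×-dec walk? {Q ∘ (u ∷_)} (Q? ∘ (u ∷_)) n v w)

module _ (G : Graph) where
  open Graph G hiding (V)

  -- The length n counts edges; uniqueness of the support makes a walk a path.
  Path : ℕ → V G → V G → Set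
  Path n u v = Σ[ p ∈ Walk G n u v ] Unique (support p)

  path? : ∀ u v → U.Decidable (λ n → Path n u v)
  path? u v n = walk? (unique? _≟_) n u v

  Connected : Set
  Connected = ∀ u v → ∃[ n ] Path n u v

  -- The minimum of the set of lengths of u–v paths, the minimum of ∅
  -- being ∞. Restricting to lengths below the order loses nothing, by
  -- path-length<order.
  distance : V G → V G → ℕ∞
  distance u v =
    Extrema.min ≤∞-totalOrder ∞ (map fin (filter (path? u v) (upTo order)))

  -- The base value 0 = distance p p only matters when G has no vertices.
  diam : ℕ∞
  diam = Extrema.max ≤∞-totalOrder (fin 0)
    (map (uncurry distance) (cartesianProduct vertices vertices))

lookup-injective : ∀ {A : Set} {xs : List A} → Unique xs →
                   ∀ {i j} → lookup xs i ≡ lookup xs j → i ≡ j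
lookup-injective (_  ∷ _ ) {zero}  {zero}  _  = refl
lookup-injective (x∉ ∷ _ ) {zero}  {suc j} eq =
  contradiction eq (All.lookup x∉ (∈-lookup j))
lookup-injective (x∉ ∷ _ ) {suc i} {zero}  eq =
  contradiction (sym eq) (All.lookup x∉ (∈-lookup i))
lookup-injective (_  ∷ xs) {suc i} {suc j} eq =
  cong suc (lookup-injective xs eq)

length-support : ∀ {G n u v} (p : Walk G n u v) → length (support p) ≡ suc n
length-support nil        = refl
length-support (cons _ p) = cong suc (length-support p)

path-length<order : ∀ {G n u v} → Path G n u v → n < ∣ G ∣
path-length<order {G} (p , uniq) = subst (ℕ._≤ ∣ G ∣) (length-support p)
  (Fin.injective⇒≤ {f = to ∘ lookup (support p)}
    (lookup-injective uniq ∘ Injection.injective (↔⇒↣ (Graph.V↔Fin G))))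
  where open Inverse (Graph.V↔Fin G) using (to)

record Subgraph (G : Graph) : Set₁ where
  open Graph G using (_~_)
  field
    _∈V    : U.Pred (V G) 0ℓ
    _∈V?   : U.Decidable _∈V
    E      : Rel (V G) 0ℓ
    E?     : Decidable E
    E-sym  : Symmetric E
    E⊆~    : ∀ {u v} → E u v → u ~ v
    E⊆V    : ∀ {u v} → E u v → u ∈V × v ∈V

↔-count : ∀ n {P : U.Pred (Fin n) 0ℓ} → U.Decidable P →
          ∃[ k ] ([ i ∈ Fin n ∣ P i ] ↔ Fin k)
↔-count zero    P? = 0 , mk↔ₛ′ (λ ()) (λ ()) (λ ()) (λ ())
↔-count (suc n) {P} P? with P? zero | ↔-count n (P? ∘ suc)
... | yes p | k , e = suc k , mk↔ₛ′ f g fg gf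
  where
  open Inverse e
  f : [ i ∈ Fin (suc n) ∣ P i ] → Fin (suc k)
  f (zero  , _) = zero
  f (suc i , q) = suc (to (i , q))
  g : Fin (suc k) → [ i ∈ Fin (suc n) ∣ P i ]
  g zero    = zero , Irrelevant.[ p ]
  g (suc j) = suc (value (from j)) , Refinement.proof (from j)
  fg : ∀ j → f (g j) ≡ j
  fg zero    = refl
  fg (suc j) = cong suc (strictlyInverseˡ j)
  gf : ∀ i → g (f i) ≡ i
  gf (zero  , _) = refl
  gf (suc i , q) = cong (λ (j , r) → suc j , r) (strictlyInverseʳ (i , q))
... | no ¬p | k , e = k , mk↔ₛ′ f g strictlyInverseˡ gf
  where
  open Inverse e renaming (to to to′; from to from′)
  f : [ i ∈ Fin (suc n) ∣ P i ] → Fin k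
  f (zero  , Irrelevant.[ q ]) = ⊥-elim-irr (¬p q)
  f (suc i , q) = to′ (i , q)
  g : Fin k → [ i ∈ Fin (suc n) ∣ P i ]
  g j = suc (value (from′ j)) , Refinement.proof (from′ j)
  gf : ∀ i → g (f i) ≡ i
  gf (zero  , Irrelevant.[ q ]) = ⊥-elim-irr (¬p q)
  gf (suc i , q) = cong (λ (j , r) → suc j , r) (strictlyInverseʳ (i , q))

↔-refine : ∀ {A B : Set} (e : A ↔ B) {P : U.Pred A 0ℓ} →
           [ a ∈ A ∣ P a ] ↔ [ b ∈ B ∣ P (Inverse.from e b) ]
↔-refine {A} {B} e {P} = mk↔ₛ′
  (λ (a , p) → to a ,
    Irrelevant.map (subst P (sym (strictlyInverseʳ a))) p)
  (λ (b , p) → from b , p)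
  (λ (b , _) → value-injective (strictlyInverseˡ b))
  (λ (a , _) → value-injective (strictlyInverseʳ a))
  where open Inverse e

module _ {G : Graph} (K : Subgraph G) where
  open Subgraph K
  open Graph G using (_~_; ~-irr; V↔Fin)

  private
    counted = ↔-count ∣ G ∣ (_∈V? ∘ Inverse.from V↔Fin)

  -- Membership proofs are irrelevant, so vertices of ⟨ K ⟩ are equal as
  -- soon as the underlying vertices of G are.
  ⟨_⟩ : Graph
  ⟨_⟩ = record
    { V     = [ v ∈ V G ∣ v ∈V ]
    ; order = proj₁ counted
    ; V↔Fin = proj₂ counted ↔-∘ ↔-refine V↔Fin
    ; _~_   = λ u v → E (value u) (value v)
    ; _~?_  = λ u v → E? (value u) (value v)
    ; ~-sym = E-sym
    ; ~-irr = λ { refl → ~-irr refl ∘ E⊆~ }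
    }

  Nonempty : Set
  Nonempty = ∃ _∈V

  Induced : Set
  Induced = ∀ {u v} → u ∈V → v ∈V → u ~ v → E u v

  Isometric : Set
  Isometric = ∀ (u v : V ⟨_⟩) →
    distance ⟨_⟩ u v ≡ distance G (value u) (value v)

induced : (G : Graph) {P : U.Pred (V G) 0ℓ} → U.Decidable P → Subgraph G
induced G {P} P? = record
  { _∈V   = P
  ; _∈V?  = P?
  ; E     = λ u v → P u × P v × u ~ v
  ; E?    = λ u v → P? u ×-dec P? v ×-dec (u ~? v)
  ; E-sym = λ (p , q , e) → q , p , ~-sym e
  ; E⊆~   = λ (_ , _ , e) → e
  ; E⊆V   = λ (p , q , _) → p , q
  }
  where open Graph G

infix 8 _[_]

_[_] : Graph → Graph → Graph
G [ H ] = record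
  { V     = V G × V H
  ; order = ∣ G ∣ ℕ.* ∣ H ∣
  ; V↔Fin = ↔-sym Fin.*↔× ↔-∘ (G.V↔Fin ×-↔ H.V↔Fin)
  ; _~_   = λ (u , x) (v , y) → u G.~ v ⊎ (x H.~ y × u ≡ v)
  ; _~?_  = λ (u , x) (v , y) → (u G.~? v) ⊎-dec ((x H.~? y) ×-dec (u G.≟ v))
  ; ~-sym = λ { (inj₁ e)       → inj₁ (G.~-sym e)
              ; (inj₂ (e , p)) → inj₂ (H.~-sym e , sym p) }
  ; ~-irr = λ { refl (inj₁ e)       → G.~-irr refl e
              ; refl (inj₂ (e , _)) → H.~-irr refl e }
  }
  where
  module G = Graph G
  module H = Graph H

π : {G H : Graph} → Subgraph (G [ H ]) → Subgraph G
π {G} {H} K = induced G {λ u → ∃[ x ] (u , x) ∈V}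
  (λ u → Graph.any? H (λ x → (u , x) ∈V?))
  where open Subgraph K

{-# OPTIONS --safe #-}

-- A distance is determined by the walk lengths bounding it, so K is isometric
-- iff walks of the ambient graph can be replaced by walks of K that are no
-- longer. Walks of K project to π(K), dropping the steps inside a fibre, and
-- nonempty walks of π(K) lift to K with arbitrary prescribed ends over their
-- ends. Only pairs in a common fibre escape this correspondence; at such a
-- pair G[H] has distance at most 2, through a neighbouring fibre.

module Submission where

open import Defs
open import Data.Fin using (Fin; zero; suc; punchIn)
open import Data.Fin.Properties using (punchInᵢ≢i)
import Data.Irrelevant as Irrelevant
open import Data.List using (map; upTo; filter; cartesianProduct)
import Data.List.Extrema as Extrema
open import Data.List.Membership.Propositional using (_∈_)
open import Data.List.Membership.Propositional.Properties
  using (∈-map⁺; ∈-filter⁺; ∈-upTo⁺; ∈-allFin; ∈-cartesianProduct⁺)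
import Data.List.Membership.DecPropositional as DecMembership
import Data.List.Relation.Unary.All as All
open import Data.List.Relation.Unary.All.Properties using (¬Any⇒All¬; map⁺; all-filter)
open import Data.List.Relation.Unary.AllPairs using ([]; _∷_)
open import Data.List.Relation.Unary.Any using (here; there)
open import Data.List.Relation.Unary.Unique.Propositional using (Unique)
open import Data.Nat using (ℕ; zero; suc; _≤_; _≥_; z≤n; s≤s)
open import Data.Nat.Properties using (≤-refl; ≤-trans; m≤n⇒m≤1+n)
open import Data.Product using (_×_; _,_; proj₁; proj₂; ∃-syntax; uncurry)
import Data.Refinement as Refinement
open import Data.Refinement using (_,_; value; value-injective)
open import Data.Sum using (_⊎_; inj₁; inj₂; map₂)
open import Function using (_∘_; id; Inverse; Injection)
open import Function.Bundles using (_⇔_; mk⇔)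
open import Function.Properties.Inverse using (↔⇒↣)
open import Relation.Binary using (TotalOrder)
open import Relation.Binary.Construct.Add.Supremum.NonStrict _≤_
  using (_≤⊤⁺; [≤]-injective) renaming ([_] to fin≤)
open import Relation.Binary.PropositionalEquality
  using (_≡_; _≢_; refl; sym; trans; cong; subst)
open import Relation.Nullary using (yes; no; contradiction; recompute)

open Graph using (V)
open Subgraph using (_∈V; _∈V?; E; E⊆~; E⊆V)

-- Distances as bounds on walk lengths.

private
  variable
    G H : Graph
    m n : ℕ

  module ℕ∞-Order = TotalOrder ≤∞-totalOrder

-- Reduces comparing distances to transferring finite bounds, hence walks. If `x` is infinite there
-- is no bound to transfer, but every `y` lies below it.
≤∞-from-bounds : ∀ {x y} → (∀ {n} → x ≤∞ fin n → y ≤∞ fin n) → y ≤∞ x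
≤∞-from-bounds {fin _} f = f ℕ∞-Order.refl
≤∞-from-bounds {∞}     f = _ ≤⊤⁺

-- Walks replace paths because the projection of a path may repeat vertices; the slack `m ≤ n`
-- absorbs steps lost in projecting or in erasing loops.
Within : (G : Graph) → ℕ → V G → V G → Set
Within G n u v = ∃[ m ] m ≤ n × Walk G m u v

within-mono : ∀ {u v} → m ≤ n → Within G m u v → Within G n u v
within-mono m≤n (l , l≤m , p) = l , ≤-trans l≤m m≤n , p

walk₀⇒≡ : ∀ {u v} → Walk G 0 u v → u ≡ v
walk₀⇒≡ nil = refl

path-suffix : ∀ {u v w} (p : Walk G n v w) → Unique (support p) →
              u ∈ support p → ∃[ m ] m ≤ n × Path G m u w
path-suffix nil          uniq       (here refl) = _ , ≤-refl , nil , uniq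
path-suffix p@(cons _ _) uniq       (here refl) = _ , ≤-refl , p , uniq
path-suffix (cons _ p)   (_ ∷ uniq) (there u∈)  =
  let m , m≤n , q = path-suffix p uniq u∈ in m , m≤n⇒m≤1+n m≤n , q

-- Loop erasure: if the new first vertex already lies on the path, only the suffix starting there is
-- kept.
walk⇒path : ∀ {u v} → Walk G n u v → ∃[ m ] m ≤ n × Path G m u v
walk⇒path nil = 0 , z≤n , nil , All.[] ∷ []
walk⇒path {G} {u = u} (cons e p) with walk⇒path p
... | m , m≤n , q , uniq with DecMembership._∈?_ (Graph._≟_ G) u (support q)
...   | no u∉  = suc m , s≤s m≤n , cons e q , ¬Any⇒All¬ _ u∉ ∷ uniq
...   | yes u∈ =
  let l , l≤m , r = path-suffix q uniq u∈
  in l , m≤n⇒m≤1+n (≤-trans l≤m m≤n) , r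

within⇒distance≤ : (G : Graph) (u v : V G) → Within G n u v → distance G u v ≤∞ fin n
within⇒distance≤ G u v (m , m≤n , p) =
  let l , l≤m , q = walk⇒path p
      -- Passing to a path guarantees a length below the order, the range that `distance` searches.
      l∈ = ∈-filter⁺ (path? G u v) (∈-upTo⁺ (path-length<order q)) q
  in ℕ∞-Order.trans
       (All.lookup (Extrema.min≤xs ≤∞-totalOrder ∞
         (map fin (filter (path? G u v) (upTo ∣ G ∣)))) (∈-map⁺ fin l∈))
       (fin≤ (≤-trans l≤m m≤n))

distance≤⇒within : (G : Graph) (u v : V G) → distance G u v ≤∞ fin n → Within G n u v
distance≤⇒within {n} G u v = Extrema.argmin-all ≤∞-totalOrder id
  {P = λ d → d ≤∞ fin n → Within G n u v}
  -- The default `∞` of the minimum satisfies no finite bound.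
  (λ ())
  (map⁺ {f = fin} (All.map (λ (p , _) m≤n → _ , [≤]-injective m≤n , p)
    (all-filter (path? G u v) (upTo ∣ G ∣))))

∈-vertices : (G : Graph) (v : V G) → v ∈ Graph.vertices G
∈-vertices G v = subst (_∈ Graph.vertices G) (strictlyInverseʳ v)
  (∈-map⁺ from (∈-allFin (to v)))
  where open Inverse (Graph.V↔Fin G)

distance≤diam : (G : Graph) (u v : V G) → distance G u v ≤∞ diam G
distance≤diam G u v = All.lookup (Extrema.xs≤max ≤∞-totalOrder (fin 0)
    (map (uncurry (distance G)) (cartesianProduct (Graph.vertices G) (Graph.vertices G))))
  (∈-map⁺ (uncurry (distance G)) (∈-cartesianProduct⁺ (∈-vertices G u) (∈-vertices G v)))

diam≤ : (G : Graph) → (∀ u v → Within G n u v) → diam G ≤∞ fin n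
diam≤ {n} G within = Extrema.argmax-all ≤∞-totalOrder id
  {P = _≤∞ fin n}
  -- The default `fin 0` of the maximum is below every bound.
  (fin≤ z≤n)
  (map⁺ {f = uncurry (distance G)} (All.universal
    (λ (u , v) → within⇒distance≤ G u v (within u v))
    (cartesianProduct (Graph.vertices G) (Graph.vertices G))))

-- Images and lifts of walks.

module _ (A B : Graph) (f : V A → V B)
         (hom : ∀ a b → Graph._~_ A a b → Graph._~_ B (f a) (f b) ⊎ f a ≡ f b) where

  -- An edge collapsed by `f` is dropped, so the length can only decrease.
  walk-image : ∀ {a b} → Walk A n a b → Within B n (f a) (f b)
  walk-image nil = 0 , z≤n , nil
  walk-image {b = b} (cons e p) with hom _ _ e | walk-image p
  ... | inj₁ e′ | m , m≤n , q = suc m , s≤s m≤n , cons e′ q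
  ... | inj₂ eq | m , m≤n , q =
    m , m≤n⇒m≤1+n m≤n , subst (λ c → Walk B m c (f b)) (sym eq) q

  within-image : ∀ {a b} → Within A n a b → Within B n (f a) (f b)
  within-image (m , m≤n , p) = within-mono m≤n (walk-image p)

module _ (A B : Graph) (f : V B → V A)
         (surj : ∀ a → ∃[ b ] f b ≡ a)
         (reflect : ∀ b c → Graph._~_ A (f b) (f c) → Graph._~_ B b c) where

  -- Interior vertices are lifted arbitrarily. Vertices with adjacent images are adjacent, so the
  -- last step can land on the prescribed `c`. Length 0 is excluded: `f b ≡ f c` need not give
  -- `b ≡ c`.
  walk-lift : ∀ {b c} → Walk A (suc n) (f b) (f c) → Walk B (suc n) b c
  walk-lift (cons e nil) = cons (reflect _ _ e) nil
  walk-lift (cons {v = v} e (cons e′ p)) with b , refl ← surj v =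
    cons (reflect _ _ e) (walk-lift (cons e′ p))

  within-lift : ∀ {b c} → f b ≢ f c → Within A n (f b) (f c) → Within B n b c
  within-lift fb≢fc (zero  , _   , p) = contradiction (walk₀⇒≡ p) fb≢fc
  within-lift fb≢fc (suc m , m≤n , p) = suc m , m≤n , walk-lift p

-- Only the first step towards w is used, and then retraced.
detour : (G : Graph) → ∀ {u v w} → u ≢ w → Within G n u w → u ≡ v → Walk G 2 u v
detour G u≢w (_ , _ , nil)      _    = contradiction refl u≢w
detour G _   (_ , _ , cons e _) refl = cons e (cons (Graph.~-sym G e) nil)

∃-other : (G : Graph) → ∣ G ∣ ≥ 2 → ∀ u → ∃[ v ] u ≢ v
∃-other G 2≤∣G∣ u =
  let j , j≢ = other 2≤∣G∣ (to u)
  in from j , λ u≡ → j≢ (trans (sym (strictlyInverseˡ j)) (cong to (sym u≡)))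
  where
  open Inverse (Graph.V↔Fin G)
  other : ∀ {n} → n ≥ 2 → (i : Fin n) → ∃[ j ] j ≢ i
  other (s≤s (s≤s _)) i = punchIn i zero , punchInᵢ≢i i zero

order≡1⇒≡ : (G : Graph) → ∣ G ∣ ≡ 1 → (u v : V G) → u ≡ v
order≡1⇒≡ G ∣G∣≡1 u v = injective (unique ∣G∣≡1 (to u) (to v))
  where
  open Injection (↔⇒↣ (Graph.V↔Fin G))
  unique : ∀ {n} → n ≡ 1 → (i j : Fin n) → i ≡ j
  unique refl zero zero = refl

-- Isometry in terms of walks.

module _ (K : Subgraph G) where

  -- The stored membership proof is irrelevant; decidability recovers a usable one.
  ∈V-value : (p : V ⟨ K ⟩) → (K ∈V) (value p)
  ∈V-value (v , Irrelevant.[ v∈ ]) = recompute ((K ∈V?) v) v∈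

  isometric⇒within : Isometric K → ∀ p q →
                     Within G n (value p) (value q) → Within ⟨ K ⟩ n p q
  isometric⇒within {n} iso p q =
    distance≤⇒within ⟨ K ⟩ p q ∘ subst (_≤∞ fin n) (sym (iso p q)) ∘
    within⇒distance≤ G (value p) (value q)

  -- The opposite inequality is automatic, since walks of `K` are walks of `G`.
  within⇒isometric : (∀ {n} p q → Within G n (value p) (value q) → Within ⟨ K ⟩ n p q) →
                     Isometric K
  within⇒isometric f p q = ℕ∞-Order.antisym
    (≤∞-from-bounds (within⇒distance≤ ⟨ K ⟩ p q ∘ f p q ∘ distance≤⇒within G (value p) (value q)))
    (≤∞-from-bounds (within⇒distance≤ G (value p) (value q) ∘
      within-image ⟨ K ⟩ G value (λ _ _ → inj₁ ∘ E⊆~ K) ∘ distance≤⇒within ⟨ K ⟩ p q))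

  -- Walks of length 0 or 1 between vertices of an induced subgraph already lie in it, so only
  -- bounds from 2 on need an argument.
  induced⇒isometric : Induced K →
    (∀ {n} p q → 2 ≤ n → Within G n (value p) (value q) → Within ⟨ K ⟩ n p q) →
    Isometric K
  induced⇒isometric ind f = within⇒isometric go
    where
    go : ∀ {n} p q → Within G n (value p) (value q) → Within ⟨ K ⟩ n p q
    go p q (0 , _ , w) with refl ← value-injective {v = p} {q} (walk₀⇒≡ w) = 0 , z≤n , nil
    go p q (1 , 1≤n , cons e nil) = 1 , 1≤n , cons (ind (∈V-value p) (∈V-value q) e) nil
    go p q (suc (suc m) , 2+m≤n , w) = within-mono 2+m≤n (f p q (s≤s (s≤s z≤n)) (_ , ≤-refl , w))

-- The lexicographic product and its projection.

module _ (G H : Graph) where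

  within-proj₁ : ∀ {p q} → Within (G [ H ]) n p q → Within G n (proj₁ p) (proj₁ q)
  within-proj₁ = within-image (G [ H ]) G proj₁ (λ _ _ → map₂ proj₂)

  lex-walk-lift : ∀ {p q : V (G [ H ])} →
    Walk G (suc n) (proj₁ p) (proj₁ q) → Walk (G [ H ]) (suc n) p q
  -- The coordinate `x` of the start supplies a vertex in every fibre.
  lex-walk-lift {p = _ , x} = walk-lift G (G [ H ]) proj₁ (λ u → (u , x) , refl) (λ _ _ → inj₁)

module _ (K : Subgraph (G [ H ])) where

  π-vertex : V ⟨ K ⟩ → V ⟨ π K ⟩
  π-vertex = Refinement.map proj₁ (λ {(_ , x)} m → x , m)

  π-vertex-surjective : ∀ u → ∃[ p ] π-vertex p ≡ u
  π-vertex-surjective u =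
    let x , m = ∈V-value (π K) u in ((value u , x) , Irrelevant.[ m ]) , refl

  π-hom : ∀ p q → E K (value p) (value q) →
          E (π K) (proj₁ (value p)) (proj₁ (value q)) ⊎ π-vertex p ≡ π-vertex q
  π-hom _ _ e with E⊆V K e | E⊆~ K e
  ... | p∈ , q∈ | inj₁ u~v       = inj₁ ((_ , p∈) , (_ , q∈) , u~v)
  ... | _       | inj₂ (_ , u≡v) = inj₂ (value-injective u≡v)

  module _ (ind : Induced K) where

    π-reflect : ∀ p q → E (π K) (proj₁ (value p)) (proj₁ (value q)) →
                E K (value p) (value q)
    π-reflect p q (_ , _ , u~v) = ind (∈V-value K p) (∈V-value K q) (inj₁ u~v)

    -- A walk of `G` is lifted to `G [ H ]` with ends in `K`, moved into `K` by isometry and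
    -- projected. The walk of length 0 is treated apart, as it has no lift between arbitrary ends.
    isometric⇒π-isometric : Isometric K → Isometric (π K)
    isometric⇒π-isometric iso = within⇒isometric (π K) go
      where
      go : ∀ {n} u v → Within G n (value u) (value v) → Within ⟨ π K ⟩ n u v
      go u v (0 , _ , nil) = 0 , z≤n , nil
      go u v (suc m , m<n , w)
        with p , refl ← π-vertex-surjective u
           | q , refl ← π-vertex-surjective v =
        within-mono m<n
          (within-image ⟨ K ⟩ ⟨ π K ⟩ π-vertex π-hom
            (isometric⇒within K iso p q (_ , ≤-refl , lex-walk-lift G H w)))

    module _ (conn : Connected G) where

      π-isometric⇒isometric : ∣ ⟨ π K ⟩ ∣ ≥ 2 → Isometric (π K) → Isometric K
      π-isometric⇒isometric 2≤∣πK∣ iso = induced⇒isometric K ind go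
        where
        go : ∀ {n} p q → 2 ≤ n →
             Within (G [ H ]) n (value p) (value q) → Within ⟨ K ⟩ n p q
        go p q 2≤n w with Graph._≟_ ⟨ π K ⟩ (π-vertex p) (π-vertex q)
        ... | no u≢v = within-lift ⟨ π K ⟩ ⟨ K ⟩ π-vertex π-vertex-surjective π-reflect u≢v
          (isometric⇒within (π K) iso (π-vertex p) (π-vertex q) (within-proj₁ G H w))
        -- Isometry moves a walk of `G` towards a second vertex of `π K` into `π K`. Its first step
        -- gives a neighbouring fibre that meets `K`, and going there and back takes 2 steps.
        ... | yes u≡v =
          let v , u≢v = ∃-other ⟨ π K ⟩ 2≤∣πK∣ (π-vertex p)
              m , w , _ = conn (proj₁ (value p)) (value v)
              w′ = isometric⇒within (π K) iso (π-vertex p) v (m , ≤-refl , w)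
          in 2 , 2≤n , walk-lift ⟨ π K ⟩ ⟨ K ⟩ π-vertex π-vertex-surjective π-reflect
               (detour ⟨ π K ⟩ u≢v w′ u≡v)

      -- All of `K` lies in one fibre, so the detour of length 2 leaves `K`; isometry then yields a
      -- walk inside `K` that is no longer.
      isometric⇒diam≤2 : ∣ G ∣ ≥ 2 → ∣ ⟨ π K ⟩ ∣ ≡ 1 → Isometric K → diam ⟨ K ⟩ ≤∞ fin 2
      isometric⇒diam≤2 2≤∣G∣ ∣πK∣≡1 iso = diam≤ ⟨ K ⟩ λ p q →
        let u = proj₁ (value p)
            v , u≢v = ∃-other G 2≤∣G∣ u
            m , w , _ = conn u v
            u≡v = cong value (order≡1⇒≡ ⟨ π K ⟩ ∣πK∣≡1 (π-vertex p) (π-vertex q))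
        in isometric⇒within K iso p q (2 , ≤-refl , lex-walk-lift G H
             (detour G u≢v (m , ≤-refl , w) u≡v))

    -- The diameter bound covers exactly the lengths that `induced⇒isometric` leaves open.
    diam≤2⇒isometric : diam ⟨ K ⟩ ≤∞ fin 2 → Isometric K
    diam≤2⇒isometric diam≤2 = induced⇒isometric K ind λ p q 2≤n _ →
      within-mono 2≤n (distance≤⇒within ⟨ K ⟩ p q (ℕ∞-Order.trans (distance≤diam ⟨ K ⟩ p q) diam≤2))

corollary3p4 : (G : Graph) → Connected G → ∣ G ∣ ≥ 2 →
    (H : Graph) (K : Subgraph (G [ H ])) → Induced K → Nonempty K →
    (∣ ⟨ π K ⟩ ∣ ≥ 2 → (Isometric K ⇔ Isometric (π K)))
    × (∣ ⟨ π K ⟩ ∣ ≡ 1 → (Isometric K ⇔ diam ⟨ K ⟩ ≤∞ fin 2))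
corollary3p4 G conn 2≤∣G∣ H K ind _ =
  (λ 2≤∣πK∣ → mk⇔ (isometric⇒π-isometric K ind) (π-isometric⇒isometric K ind conn 2≤∣πK∣)) ,
  (λ ∣πK∣≡1 → mk⇔ (isometric⇒diam≤2 K ind conn 2≤∣G∣ ∣πK∣≡1) (diam≤2⇒isometric K ind))
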